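{- For every odd integer $k\ge 5$, the set $M=\{v_1^tv_7^t,\ v_2^tv_8^t,\ v_3^tv_4^t,\ v_5^tv_6^t : 1\le t\le k\}$ is a planarizing perfect matching of the Goldberg snark $G_k$; that is, $M$ is a perfect matching and $G_k/M$ is planar.
   Context: For a perfect matching $M$ of a graph $G$, $G/M$ is the (multi)graph obtained by contracting each edge of $M$ to a single vertex. For odd $k\ge 5$, the Goldberg snark $G_k$ has vertex set $\{v_j^t : 1\le t\le k,\ 1\le j\le 8\}$. For each $t$, the vertices $v_1^t,\dots,v_8^t$ induce a basic block with edges $v_1^tv_2^t,\ v_1^tv_7^t,\ v_2^tv_8^t,\ v_3^tv_4^t,\ v_3^tv_8^t,\ v_4^tv_7^t,\ v_5^tv_6^t,\ v_6^tv_7^t,\ v_6^tv_8^t$. In addition, for each $t$ there are edges $v_2^tv_1^{t+1},\ v_4^tv_3^{t+1},\ v_5^tv_5^{t+1}$, where superscripts are read modulo $k$. -}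

module Defs where

open import Data.Fin.Base using (Fin; zero; suc; inject₁; fromℕ; toℕ)
open import Data.List.Base using (_∷_; [])
open import Data.List.Membership.Propositional using (_∈_)
open import Data.Nat.Base as ℕ using (ℕ; NonZero)
open import Data.Nat.DivMod using (_mod_)
open import Data.Product using (_×_; _,_; ∃; ∃!; proj₁; proj₂)
open import Data.Rational.Base using (ℚ; 0ℚ; 1ℚ; _+_; _-_; _*_; _≤_; _<_)
open import Data.Sum.Base using (_⊎_)
open import Function.Bundles using (Injection)
open import Level using (0ℓ)
open import Relation.Binary.Bundles using (Setoid)
open import Relation.Binary.Construct.Closure.Equivalence as EqClosure using ()
open import Relation.Binary.Construct.Union using (_∪_)
open import Relation.Binary.Core using (Rel)
open import Relation.Binary.PropositionalEquality
  using (_≡_; _≢_; setoid)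
open import Relation.Nullary.Negation using (¬_)
open import Relation.Unary using (Pred; ∁)

------------------------------------------------------------------------
-- Multigraphs

-- Parallel edges and loops are allowed.  Vertices form a setoid so that
-- the vertex set of a contraction can be a quotient.  The order of the two
-- ends of an edge carries no meaning.

record Multigraph : Set₁ where
  field
    vertices : Setoid 0ℓ 0ℓ
    Edge     : Set

  open Setoid vertices public using (_≈_) renaming (Carrier to Vertex)

  field
    ends : Edge → Vertex × Vertex

  source target : Edge → Vertex
  source e = proj₁ (ends e)
  target e = proj₂ (ends e)

  Incident : Edge → Vertex → Set
  Incident e v = v ≈ source e ⊎ v ≈ target e

record IsPerfectMatching (G : Multigraph)
                         (M : Pred (Multigraph.Edge G) 0ℓ) : Set where
  open Multigraph G
  field
    loopless : ∀ {e} → M e → ¬ (source e ≈ target e)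
    covers   : ∀ v → ∃! _≡_ (λ e → M e × Incident e v)

-- Contraction of the edges in M: the ends of each edge of M are identified
-- and the edges of M disappear; any other edge that becomes a loop or
-- parallel to another one is kept.

module _ (G : Multigraph) (M : Pred (Multigraph.Edge G) 0ℓ) where
  open Multigraph G

  Joined : Rel Vertex 0ℓ
  Joined u v = ∃ λ e → M e × u ≈ source e × v ≈ target e

  contract : Multigraph
  contract = record
    { vertices = EqClosure.setoid (_≈_ ∪ Joined)
    ; Edge     = ∃ (∁ M)
    ; ends     = λ (e , _) → ends e
    }

------------------------------------------------------------------------
-- Planarity

-- A graph is planar if it can be drawn in the plane with distinct points
-- for distinct vertices and polygonal arcs for edges, such that the
-- interior of each arc contains no vertex and meets no other arc.
-- Coordinates are rational: two segments with rational end points that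
-- meet in the real plane also meet in a rational point, so a drawing in
-- the sense below is a drawing in the real plane.  Conversely, bends and
-- vertices of a drawing of a finite graph can be perturbed into ℚ².

Point : Set
Point = ℚ × ℚ

-- The point dividing the segment from p to q at parameter s ∈ [0,1].
lerp : Point → Point → ℚ → Point
lerp (x , y) (x′ , y′) s =
  (1ℚ - s) * x + s * x′ , (1ℚ - s) * y + s * y′

-- A polygonal path, consisting of at least one segment.
record Path : Set where
  field
    bends  : ℕ
    corner : Fin (ℕ.suc (ℕ.suc bends)) → Point

  start finish : Point
  start  = corner zero
  finish = corner (fromℕ (ℕ.suc bends))

  Param : Set
  Param = Fin (ℕ.suc bends) × ℚ

  at : Param → Point
  at (i , s) = lerp (corner (inject₁ i)) (corner (suc i)) s

  -- The parameters other than those of the two end points of the path.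
  -- As s < 1, each corner has only one parameter, namely (i , 0).
  Interior : Pred Param 0ℓ
  Interior (i , s) = 0ℚ ≤ s × s < 1ℚ × (i ≡ zero → 0ℚ < s)

record Drawing (G : Multigraph) : Set where
  open Multigraph G
  field
    position : Injection vertices (setoid Point)
    path     : Edge → Path

  open Injection position public using () renaming (to to pos)
  module Arc (e : Edge) = Path (path e)

  field
    starts   : ∀ e → Arc.start e ≡ pos (source e)
    finishes : ∀ e → Arc.finish e ≡ pos (target e)

    -- Together with avoids, this makes each path a simple arc, or a simple
    -- closed curve in the case of a loop.
    simple   : ∀ e {p q} → Arc.Interior e p → Arc.Interior e q →
               Arc.at e p ≡ Arc.at e q → p ≡ q
    avoids   : ∀ e {p} → Arc.Interior e p → ∀ v → Arc.at e p ≢ pos v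
    disjoint : ∀ {e f} → e ≢ f →
               ∀ {p q} → Arc.Interior e p → Arc.Interior f q →
               Arc.at e p ≢ Arc.at f q

Planar : Multigraph → Set
Planar G = Drawing G

IsPlanarizingPerfectMatching :
  (G : Multigraph) → Pred (Multigraph.Edge G) 0ℓ → Set
IsPlanarizingPerfectMatching G M =
  IsPerfectMatching G M × Planar (contract G M)

------------------------------------------------------------------------
-- Goldberg snarks

-- The superscript t ranges over Fin k, that is, over 0, …, k - 1.

data GoldbergVertex (k : ℕ) : Set where
  v₁ v₂ v₃ v₄ v₅ v₆ v₇ v₈ : Fin k → GoldbergVertex k

data GoldbergEdge (k : ℕ) : Set where
  v₁v₂ v₁v₇ v₂v₈ v₃v₄ v₃v₈ v₄v₇ v₅v₆ v₆v₇ v₆v₈ : Fin k → GoldbergEdge k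
  -- The second end of these lies in the next block.
  v₂v₁⁺ v₄v₃⁺ v₅v₅⁺ : Fin k → GoldbergEdge k

module _ (k : ℕ) .{{_ : NonZero k}} where

  next : Fin k → Fin k
  next t = ℕ.suc (toℕ t) mod k

  goldbergEnds : GoldbergEdge k → GoldbergVertex k × GoldbergVertex k
  goldbergEnds (v₁v₂ t)  = v₁ t , v₂ t
  goldbergEnds (v₁v₇ t)  = v₁ t , v₇ t
  goldbergEnds (v₂v₈ t)  = v₂ t , v₈ t
  goldbergEnds (v₃v₄ t)  = v₃ t , v₄ t
  goldbergEnds (v₃v₈ t)  = v₃ t , v₈ t
  goldbergEnds (v₄v₇ t)  = v₄ t , v₇ t
  goldbergEnds (v₅v₆ t)  = v₅ t , v₆ t
  goldbergEnds (v₆v₇ t)  = v₆ t , v₇ t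
  goldbergEnds (v₆v₈ t)  = v₆ t , v₈ t
  goldbergEnds (v₂v₁⁺ t) = v₂ t , v₁ (next t)
  goldbergEnds (v₄v₃⁺ t) = v₄ t , v₃ (next t)
  goldbergEnds (v₅v₅⁺ t) = v₅ t , v₅ (next t)

  -- For k ≥ 3 no two edges have the same pair of ends and there are no
  -- loops, so this is a simple graph.
  goldberg : Multigraph
  goldberg = record
    { vertices = setoid (GoldbergVertex k)
    ; Edge     = GoldbergEdge k
    ; ends     = goldbergEnds
    }

goldbergMatching : ∀ {k} → Pred (GoldbergEdge k) 0ℓ
goldbergMatching e =
  ∃ λ t → e ∈ v₁v₇ t ∷ v₂v₈ t ∷ v₃v₄ t ∷ v₅v₆ t ∷ []

{-# OPTIONS --safe #-}
module Submission where

-- Contracting M leaves, in each block, the vertices a = {v₁,v₇}, b = {v₂,v₈},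
-- c = {v₃,v₄}, d = {v₅,v₆} with edges ab, ca, cb, da, db; the blocks are joined by an
-- inner cycle through the c, a middle cycle a b a b … and an outer cycle through the d.
-- The cycles are drawn on concentric triangles, with all vertices on the vertical sides
-- x = 1, 2, 3: block t occupies heights from 2t up to 2t + 2, where its edges other
-- than those of the cycles join neighbouring sides.  The last edge of each cycle goes
-- around its triangle.  The coordinates of a point determine the only vertex or edge it
-- can lie on, which gives all disjointness requirements at once.

open import Data.Fin.Base as Fin using (Fin; zero; suc; toℕ)
import Data.Fin.Properties as Fin
open import Data.List.Relation.Unary.Any using (here; there)
open import Data.Nat.Base as ℕ using (ℕ; NonZero; _≤_; _%_)
import Data.Nat.DivMod as ℕ
import Data.Nat.Properties as ℕ
open import Data.Product using (_×_; _,_; ∃₂; proj₁; proj₂; uncurry)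
open import Data.Rational.Base as ℚ
  using (ℚ; 0ℚ; 1ℚ; _+_; _-_; _*_; -_; _<_; positive; nonNegative)
open import Data.Rational.Properties hiding (_≟_)
import Data.Rational.Properties as ℚ
open import Data.Rational.Solver using (module +-*-Solver)
open import Data.Sum.Base using (_⊎_; inj₁; inj₂)
open import Data.Sum.Properties using (inj₂-injective)
open import Function.Base using (_∘_; case_of_)
open import Relation.Binary.Bundles using (Setoid)
open import Relation.Binary.Construct.Closure.Equivalence as EqClosure using ()
open import Relation.Binary.Construct.Closure.ReflexiveTransitive using (ε)
open import Relation.Binary.Definitions using (tri<; tri≈; tri>)
open import Relation.Binary.PropositionalEquality
  using (_≡_; _≢_; refl; sym; trans; cong; cong₂; subst; isEquivalence;
         module ≡-Reasoning)
open import Relation.Nullary.Decidable using (yes; no)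
open import Relation.Nullary.Negation using (¬_; contradiction)
open import Defs

open +-*-Solver using (solve; _:+_; _:*_; _:-_; :-_; con; _:=_)

2ℚ 3ℚ : ℚ
2ℚ = 1ℚ + 1ℚ
3ℚ = 2ℚ + 1ℚ

-- Linear interpolation

lerp₁ : ℚ → ℚ → ℚ → ℚ
lerp₁ a b s = (1ℚ - s) * a + s * b

a<b⇒0<b-a : ∀ {a b} → a < b → 0ℚ < b - a
a<b⇒0<b-a {a} {b} a<b = subst (_< b - a) (+-inverseʳ a) (+-monoˡ-< (- a) a<b)

a<a+d : ∀ {a d} → 0ℚ < d → a < a + d
a<a+d {a} {d} 0<d = subst (_< a + d) (+-identityʳ a) (+-monoʳ-< a 0<d)

q<q+1 : ∀ {q} → q < q + 1ℚ
q<q+1 = a<a+d (positive⁻¹ 1ℚ)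

lerp₁-const : ∀ a s → lerp₁ a a s ≡ a
lerp₁-const = solve 2 (λ a s → (con 1ℚ :- s) :* a :+ s :* a := a) refl

module _ {a b a′ b′ s : ℚ} where

  lerp₁-mono-≤ : 0ℚ ℚ.≤ s → s < 1ℚ → a ℚ.≤ a′ → b ℚ.≤ b′ →
                 lerp₁ a b s ℚ.≤ lerp₁ a′ b′ s
  lerp₁-mono-≤ 0≤s s<1 a≤a′ b≤b′ = +-mono-≤
    (*-monoˡ-≤-nonNeg (1ℚ - s) {{nonNegative (<⇒≤ (a<b⇒0<b-a s<1))}} a≤a′)
    (*-monoˡ-≤-nonNeg s {{nonNegative 0≤s}} b≤b′)

  lerp₁-monoˡ-< : 0ℚ ℚ.≤ s → s < 1ℚ → a < a′ → b ℚ.≤ b′ →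
                  lerp₁ a b s < lerp₁ a′ b′ s
  lerp₁-monoˡ-< 0≤s s<1 a<a′ b≤b′ = +-mono-<-≤
    (*-monoʳ-<-pos (1ℚ - s) {{positive (a<b⇒0<b-a s<1)}} a<a′)
    (*-monoˡ-≤-nonNeg s {{nonNegative 0≤s}} b≤b′)

  lerp₁-monoʳ-< : 0ℚ < s → s < 1ℚ → a ℚ.≤ a′ → b < b′ →
                  lerp₁ a b s < lerp₁ a′ b′ s
  lerp₁-monoʳ-< 0<s s<1 a≤a′ b<b′ = +-mono-≤-<
    (*-monoˡ-≤-nonNeg (1ℚ - s) {{nonNegative (<⇒≤ (a<b⇒0<b-a s<1))}} a≤a′)
    (*-monoʳ-<-pos s {{positive 0<s}} b<b′)

module _ {a b s : ℚ} where

  lerp₁-≤ : 0ℚ ℚ.≤ s → s < 1ℚ → b ℚ.≤ a → lerp₁ a b s ℚ.≤ a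
  lerp₁-≤ 0≤s s<1 b≤a =
    subst (lerp₁ a b s ℚ.≤_) (lerp₁-const a s) (lerp₁-mono-≤ 0≤s s<1 ≤-refl b≤a)

  lerp₁-<ʳ : 0ℚ ℚ.≤ s → s < 1ℚ → a < b → lerp₁ a b s < b
  lerp₁-<ʳ 0≤s s<1 a<b =
    subst (lerp₁ a b s <_) (lerp₁-const b s) (lerp₁-monoˡ-< 0≤s s<1 a<b ≤-refl)

  lerp₁-<ˡ : 0ℚ < s → s < 1ℚ → b < a → lerp₁ a b s < a
  lerp₁-<ˡ 0<s s<1 b<a =
    subst (lerp₁ a b s <_) (lerp₁-const a s) (lerp₁-monoʳ-< 0<s s<1 ≤-refl b<a)

  lerp₁->ʳ : 0ℚ ℚ.≤ s → s < 1ℚ → b < a → b < lerp₁ a b s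
  lerp₁->ʳ 0≤s s<1 b<a =
    subst (_< lerp₁ a b s) (lerp₁-const b s) (lerp₁-monoˡ-< 0≤s s<1 b<a ≤-refl)

  lerp₁->ˡ : 0ℚ < s → s < 1ℚ → a < b → a < lerp₁ a b s
  lerp₁->ˡ 0<s s<1 a<b =
    subst (_< lerp₁ a b s) (lerp₁-const a s) (lerp₁-monoʳ-< 0<s s<1 ≤-refl a<b)

-- Subtracting a and dividing by b - a, which is nonzero, recovers the parameter.
lerp₁-injective : ∀ {a b s s′} → a ≢ b → lerp₁ a b s ≡ lerp₁ a b s′ → s ≡ s′
lerp₁-injective {a} {b} {s} {s′} a≢b eq = begin
  s                        ≡⟨ slope s ⟨
  (lerp₁ a b s - a) * d⁻¹  ≡⟨ cong (λ y → (y - a) * d⁻¹) eq ⟩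
  (lerp₁ a b s′ - a) * d⁻¹ ≡⟨ slope s′ ⟩
  s′                       ∎
  where
  open ≡-Reasoning
  b-a≢0 : b - a ≢ 0ℚ
  b-a≢0 b-a≡0 = a≢b (begin
    a             ≡⟨ +-identityˡ a ⟨
    0ℚ + a        ≡⟨ cong (_+ a) b-a≡0 ⟨
    (b - a) + a   ≡⟨ solve 2 (λ a b → (b :- a) :+ a := b) refl a b ⟩
    b             ∎)
  instance
    _ : ℚ.NonZero (b - a)
    _ = ℚ.≢-nonZero b-a≢0
  d⁻¹ : ℚ
  d⁻¹ = ℚ.1/ (b - a)
  slope : ∀ s → (lerp₁ a b s - a) * d⁻¹ ≡ s
  slope s = begin
    (lerp₁ a b s - a) * d⁻¹ ≡⟨ solve 4 (λ a b s d →
      ((con 1ℚ :- s) :* a :+ s :* b :- a) :* d := s :* ((b :- a) :* d))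
      refl a b s d⁻¹ ⟩
    s * ((b - a) * d⁻¹)     ≡⟨ cong (s *_) (*-inverseʳ (b - a)) ⟩
    s * 1ℚ                  ≡⟨ *-identityʳ s ⟩
    s                       ∎

-- Distinct points differ in some coordinate, and that coordinate alone determines the parameter.
lerp-injective : ∀ {p q s s′} → p ≢ q → lerp p q s ≡ lerp p q s′ → s ≡ s′
lerp-injective {a , c} {b , d} p≢q eq with a ℚ.≟ b
... | no  a≢b  = lerp₁-injective a≢b (cong proj₁ eq)
... | yes refl = lerp₁-injective (p≢q ∘ cong (a ,_)) (cong proj₂ eq)

-- Reading off vertices and edges within a block

data Order : Set where
  less equal greater : Order

-- Forgets the proofs carried by `<-cmp`, so that the outcome is plain data to match on and to
-- rewrite with.
compare : ℚ → ℚ → Order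
compare a b with <-cmp a b
... | tri< _ _ _ = less
... | tri≈ _ _ _ = equal
... | tri> _ _ _ = greater

module _ {a b : ℚ} where

  compare-< : a < b → compare a b ≡ less
  compare-< a<b with <-cmp a b
  ... | tri< _ _ _   = refl
  ... | tri≈ a≮b _ _ = contradiction a<b a≮b
  ... | tri> a≮b _ _ = contradiction a<b a≮b

  compare-> : b < a → compare a b ≡ greater
  compare-> b<a with <-cmp a b
  ... | tri< _ _ a≯b = contradiction b<a a≯b
  ... | tri≈ _ _ a≯b = contradiction b<a a≯b
  ... | tri> _ _ _   = refl

compare-refl : ∀ a → compare a a ≡ equal
compare-refl a with <-cmp a a
... | tri< _ a≢a _ = contradiction refl a≢a
... | tri≈ _ _ _   = refl
... | tri> _ a≢a _ = contradiction refl a≢a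

data Ring : Set where
  inner middle outer : Ring

data Place : Set where
  a b c d : Place

-- around ρ is the edge of the cycle ρ that leads to the next block.
data Link : Set where
  ab ca cb da db : Link
  around         : Ring → Link

Kind : Set
Kind = Place ⊎ Link

data Column : Set where
  on                   : Ring → Column
  insideGap outsideGap : Column

data Row : Set where
  base  : Row
  above : Order → Row

column : ℚ → Column
column x = aux (compare x 1ℚ) (compare x 2ℚ) (compare x 3ℚ)
  where
  aux : Order → Order → Order → Column
  aux equal _  _  = on inner
  aux _  equal _  = on middle
  aux _  _  equal = on outer
  -- Default values: x < 1 falls here and x > 3 in the next clause, but the parts of the drawing
  -- that are read off this way have 1 ≤ x ≤ 3.
  aux _  less _  = insideGap
  aux _  _  _  = outsideGap

row : ℚ → ℚ → Row
row h y = aux (compare y h) (compare y (h + 1ℚ))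
  where
  aux : Order → Order → Row
  aux greater o = above o
  -- This also catches y < h, which the lower bound in the constructor `near` of `Located` rules
  -- out.
  aux _  _ = base

-- In each gap one edge is horizontal at the base of the block and the other rises from the base, so
-- comparing with the base tells them apart. Only the middle side carries a second vertex of the
-- block, hence the finer distinction there.
kind : Column → Row → Kind
kind (on inner)  base       = inj₁ c
kind (on inner)  (above _)  = inj₂ (around inner)
kind insideGap   base       = inj₂ ca
kind insideGap   (above _)  = inj₂ cb
kind (on middle) base       = inj₁ a
kind (on middle) (above less) = inj₂ ab
kind (on middle) (above equal) = inj₁ b
kind (on middle) (above greater) = inj₂ (around middle)
kind outsideGap  base       = inj₂ da
kind outsideGap  (above _)  = inj₂ db
kind (on outer)  base       = inj₁ d
kind (on outer)  (above _)  = inj₂ (around outer)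

column-insideGap : ∀ {x} → 1ℚ < x → x < 2ℚ → column x ≡ insideGap
column-insideGap {x} 1<x x<2
  rewrite compare-> 1<x | compare-< x<2 | compare-< (<-trans x<2 (q<q+1 {2ℚ})) = refl

column-outsideGap : ∀ {x} → 2ℚ < x → x < 3ℚ → column x ≡ outsideGap
column-outsideGap {x} 2<x x<3
  rewrite compare-> (<-trans (q<q+1 {1ℚ}) 2<x) | compare-> 2<x | compare-< x<3 = refl

row-base : ∀ h → row h h ≡ base
row-base h rewrite compare-refl h = refl

row-above : ∀ {h y} → h < y → row h y ≡ above (compare y (h + 1ℚ))
row-above h<y rewrite compare-> h<y = refl

row-low : ∀ {h y} → h < y → y < h + 1ℚ → row h y ≡ above less
row-low h<y y<h+1 = trans (row-above h<y) (cong above (compare-< y<h+1))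

row-mid : ∀ h → row h (h + 1ℚ) ≡ above equal
row-mid h = trans (row-above q<q+1) (cong above (compare-refl (h + 1ℚ)))

row-high : ∀ {h y} → h + 1ℚ < y → row h y ≡ above greater
row-high h+1<y = trans (row-above (<-trans q<q+1 h+1<y)) (cong above (compare-> h+1<y))

-- Positions of the cycles and heights of the blocks

radius : Ring → ℚ
radius inner  = 1ℚ
radius middle = 2ℚ
radius outer  = 3ℚ

-- Where the edge around ρ leaves a block of height h.
exit : Ring → ℚ → ℚ
exit inner  h = h
exit middle h = h + 1ℚ
exit outer  h = h

0<radius : ∀ ρ → 0ℚ < radius ρ
0<radius inner  = positive⁻¹ 1ℚ
0<radius middle = positive⁻¹ 2ℚ
0<radius outer  = positive⁻¹ 3ℚ

column-radius : ∀ ρ → column (radius ρ) ≡ on ρ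
column-radius inner  = refl
column-radius middle = refl
column-radius outer  = refl

exit-≥ : ∀ ρ {h} → h ℚ.≤ exit ρ h
exit-≥ inner  = ≤-refl
exit-≥ middle = <⇒≤ q<q+1
exit-≥ outer  = ≤-refl

exit-< : ∀ ρ {h} → exit ρ h < h + 1ℚ + 1ℚ
exit-< inner  = <-trans q<q+1 q<q+1
exit-< middle = q<q+1
exit-< outer  = <-trans q<q+1 q<q+1

kind-around : ∀ ρ {h y} → exit ρ h < y → kind (on ρ) (row h y) ≡ inj₂ (around ρ)
kind-around inner  h<y   = cong (kind (on inner)) (row-above h<y)
kind-around middle h+1<y = cong (kind (on middle)) (row-high h+1<y)
kind-around outer  h<y   = cong (kind (on outer)) (row-above h<y)

-- The sequence 2n, with the successor step written so that the next block starts at `h + 1ℚ + 1ℚ`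
-- by computation.
height : ℕ → ℚ
height ℕ.zero    = 0ℚ
height (ℕ.suc n) = height n + 1ℚ + 1ℚ

height-<-suc : ∀ n → height n < height (ℕ.suc n)
height-<-suc n = <-trans q<q+1 q<q+1

height-mono-≤ : ∀ {m n} → m ℕ.≤ n → height m ℚ.≤ height n
height-mono-≤ = mono ∘ ℕ.≤⇒≤′
  where
  mono : ∀ {m n} → m ℕ.≤′ n → height m ℚ.≤ height n
  mono ℕ.≤′-refl       = ≤-refl
  mono {n = ℕ.suc n} (ℕ.≤′-step m≤n) = ≤-trans (mono m≤n) (<⇒≤ (height-<-suc n))

0≤height : ∀ n → 0ℚ ℚ.≤ height n
0≤height n = height-mono-≤ {0} {n} ℕ.z≤n

-- Concentric triangles

-- The triangle of radius r has corners (r , N + 3 r), (- (N + 2 r) , - (N + 3 r))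
-- and (r , 0).  Its sides lie on the lines x = r, upper = r and lower = r, and it is
-- the level set of max (x , upper , lower) at r, so triangles of distinct radii are
-- disjoint.

module Triangle (N : ℚ) where

  upper lower : Point → ℚ
  upper (x , y) = y - 2ℚ * x - N
  lower (x , y) = x - y

  record OnFarSides (r : ℚ) (p : Point) : Set where
    field
      right-≤ : proj₁ p ℚ.≤ r
      upper-≤ : upper p ℚ.≤ r
      lower-≤ : lower p ℚ.≤ r
      -- The strict inequality leaves out the corner (r , 0), which is the vertex where the closing
      -- edge ends.
      farSide : upper p ≡ r ⊎ (lower p ≡ r × proj₁ p < r)

  open OnFarSides public

  -- The radius r is attained at p by `upper` or `lower`, and r′ bounds both of them.
  far-radius-≤ : ∀ {p r r′} → OnFarSides r p → OnFarSides r′ p → r ℚ.≤ r′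
  far-radius-≤ {r′ = r′} P Q with farSide P
  ... | inj₁ up≡r        = subst (ℚ._≤ r′) up≡r (upper-≤ Q)
  ... | inj₂ (lo≡r , _)  = subst (ℚ._≤ r′) lo≡r (lower-≤ Q)

  far-radius : ∀ {p r r′} → OnFarSides r p → OnFarSides r′ p → r ≡ r′
  far-radius P Q = ≤-antisym (far-radius-≤ P Q) (far-radius-≤ Q P)

  upper-<-right : ∀ {x y} → y < N + 3ℚ * x → upper (x , y) < x
  upper-<-right {x} {y} y<N+3x = subst (upper (x , y) <_)
    (solve 2 (λ x N → (N :+ con 3ℚ :* x) :- con 2ℚ :* x :- N := x) refl x N)
    (+-monoˡ-< (- N) (+-monoˡ-< (- (2ℚ * x)) y<N+3x))

  lower-<-right : ∀ {x y} → 0ℚ < y → lower (x , y) < x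
  lower-<-right {x} {y} 0<y = subst (x - y <_) (+-identityʳ x)
    (+-monoʳ-< x (neg-antimono-< 0<y))

  lower-≤-right : ∀ {x y} → 0ℚ ℚ.≤ y → lower (x , y) ℚ.≤ x
  lower-≤-right {x} {y} 0≤y = subst (x - y ℚ.≤_) (+-identityʳ x)
    (+-monoʳ-≤ x (neg-antimono-≤ 0≤y))

  -- In the wedge 0 ≤ y < N + 3 x the coordinate x dominates: upper < x and lower ≤ x. Since x ≤ r,
  -- `upper` cannot reach r, and `lower` could do so only for x = r, which `farSide` excludes.
  near⇒¬far : ∀ {x y r} → 0ℚ ℚ.≤ y → y < N + 3ℚ * x → ¬ OnFarSides r (x , y)
  near⇒¬far {x} {y} 0≤y y<N+3x P with farSide P
  ... | inj₁ up≡r         = <-irrefl up≡r (<-≤-trans (upper-<-right y<N+3x) (right-≤ P))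
  ... | inj₂ (lo≡r , x<r) = <-irrefl lo≡r (≤-<-trans (lower-≤-right 0≤y) x<r)

  -- The part of the triangle from (r , e) upwards and around to (r , 0).
  module Arc (r e : ℚ) (0≤e : 0ℚ ℚ.≤ e) (e<top : e < N + 3ℚ * r) where

    top left : ℚ
    top  = N + 3ℚ * r
    left = - (N + 2ℚ * r)

    path : Path
    path = record { bends = 2 ; corner = corner }
      where
      corner : Fin 4 → Point
      corner zero                   = r , e
      corner (suc zero)             = r , top
      corner (suc (suc zero))       = left , - top
      corner (suc (suc (suc zero))) = r , 0ℚ

    open Path path using (at; Interior)

    0<top : 0ℚ < top
    0<top = ≤-<-trans 0≤e e<top

    left<r : left < r
    left<r = subst (left <_)
      (solve 2 (λ r N → :- (N :+ con 2ℚ :* r) :+ (N :+ con 3ℚ :* r) := r) refl r N)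
      (a<a+d 0<top)

    bottom-upper : ℚ
    bottom-upper = 0ℚ - 2ℚ * r - N

    top-lower<r : r - top < r
    top-lower<r = lower-<-right 0<top

    bottom-upper<r : bottom-upper < r
    bottom-upper<r = upper-<-right 0<top

    right₀ : ∀ s → proj₁ (at (zero , s)) ≡ r
    right₀ = lerp₁-const r

    -- `upper` and `lower` are affine, so along a segment they interpolate their values at the
    -- corners. On the upper side `upper` stays at r while `lower` grows from r - top to r; on the
    -- lower side `lower` stays at r while `upper` falls from r to `bottom-upper`.
    upper₁ : ∀ s → upper (at (suc zero , s)) ≡ r
    upper₁ s = solve 3 (λ r N s → let top = N :+ con 3ℚ :* r in
      ((con 1ℚ :- s) :* top :+ s :* (:- top))
        :- con 2ℚ :* ((con 1ℚ :- s) :* r :+ s :* (:- (N :+ con 2ℚ :* r))) :- N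
      := r) refl r N s

    lower₁ : ∀ s → lower (at (suc zero , s)) ≡ lerp₁ (r - top) r s
    lower₁ s = solve 3 (λ r N s → let top = N :+ con 3ℚ :* r in
      ((con 1ℚ :- s) :* r :+ s :* (:- (N :+ con 2ℚ :* r)))
        :- ((con 1ℚ :- s) :* top :+ s :* (:- top))
      := (con 1ℚ :- s) :* (r :- top) :+ s :* r) refl r N s

    upper₂ : ∀ s → upper (at (suc (suc zero) , s)) ≡ lerp₁ r bottom-upper s
    upper₂ s = solve 3 (λ r N s → let top = N :+ con 3ℚ :* r in
      ((con 1ℚ :- s) :* (:- top) :+ s :* con 0ℚ)
        :- con 2ℚ :* ((con 1ℚ :- s) :* (:- (N :+ con 2ℚ :* r)) :+ s :* r) :- N
      := (con 1ℚ :- s) :* r :+ s :* (con 0ℚ :- con 2ℚ :* r :- N)) refl r N s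

    lower₂ : ∀ s → lower (at (suc (suc zero) , s)) ≡ r
    lower₂ s = solve 3 (λ r N s → let top = N :+ con 3ℚ :* r in
      ((con 1ℚ :- s) :* (:- (N :+ con 2ℚ :* r)) :+ s :* r)
        :- ((con 1ℚ :- s) :* (:- top) :+ s :* con 0ℚ)
      := r) refl r N s

    near : ∀ {s} → Interior (zero , s) →
           e < proj₂ (at (zero , s)) × proj₂ (at (zero , s)) < top
    near (0≤s , s<1 , 0<s) = lerp₁->ˡ (0<s refl) s<1 e<top , lerp₁-<ʳ 0≤s s<1 e<top

    far₁ : ∀ {s} → Interior (suc zero , s) → OnFarSides r (at (suc zero , s))
    far₁ {s} (0≤s , s<1 , _) = record
      { right-≤ = lerp₁-≤ 0≤s s<1 (<⇒≤ left<r)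
      ; upper-≤ = ≤-reflexive (upper₁ s)
      ; lower-≤ = subst (ℚ._≤ r) (sym (lower₁ s)) (<⇒≤ (lerp₁-<ʳ 0≤s s<1 top-lower<r))
      ; farSide = inj₁ (upper₁ s)
      }

    far₂ : ∀ {s} → Interior (suc (suc zero) , s) → OnFarSides r (at (suc (suc zero) , s))
    far₂ {s} (0≤s , s<1 , _) = record
      { right-≤ = <⇒≤ right<r
      ; upper-≤ = subst (ℚ._≤ r) (sym (upper₂ s)) (lerp₁-≤ 0≤s s<1 (<⇒≤ bottom-upper<r))
      ; lower-≤ = ≤-reflexive (lower₂ s)
      ; farSide = inj₂ (lower₂ s , right<r)
      }
      where right<r = lerp₁-<ʳ 0≤s s<1 left<r

    upper₀<r : ∀ {s} → Interior (zero , s) → upper (at (zero , s)) < r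
    upper₀<r {s} I = subst (upper (at (zero , s)) <_) (right₀ s)
      (upper-<-right (subst (λ x → proj₂ (at (zero , s)) < N + 3ℚ * x)
        (sym (right₀ s)) (proj₂ (near I))))

    lower₀<r : ∀ {s} → Interior (zero , s) → lower (at (zero , s)) < r
    lower₀<r {s} I = subst (lower (at (zero , s)) <_) (right₀ s)
      (lower-<-right (≤-<-trans 0≤e (proj₁ (near I))))

    lower₁<r : ∀ {s} → Interior (suc zero , s) → lower (at (suc zero , s)) < r
    lower₁<r {s} (0≤s , s<1 , _) =
      subst (_< r) (sym (lower₁ s)) (lerp₁-<ʳ 0≤s s<1 top-lower<r)

    -- Two sides are separated by a function, `upper` or `lower`, that is constantly r on the later
    -- side and below r at interior parameters of the earlier one.
    apart₀₁ : ∀ {s} s′ → Interior (zero , s) → at (zero , s) ≢ at (suc zero , s′)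
    apart₀₁ s′ I p≡q = <-irrefl (trans (cong upper p≡q) (upper₁ s′)) (upper₀<r I)

    apart₀₂ : ∀ {s} s′ → Interior (zero , s) → at (zero , s) ≢ at (suc (suc zero) , s′)
    apart₀₂ s′ I p≡q = <-irrefl (trans (cong lower p≡q) (lower₂ s′)) (lower₀<r I)

    apart₁₂ : ∀ {s} s′ → Interior (suc zero , s) →
              at (suc zero , s) ≢ at (suc (suc zero) , s′)
    apart₁₂ s′ I p≡q = <-irrefl (trans (cong lower p≡q) (lower₂ s′)) (lower₁<r I)

    -- Within one side the parameter is recovered from a function that is not constant there: y,
    -- then `lower`, then `upper`.
    simple : ∀ {p q} → Interior p → Interior q → at p ≡ at q → p ≡ q
    simple {zero , _} {zero , _} _ _ p≡q =
      cong (zero ,_) (lerp₁-injective (<⇒≢ e<top) (cong proj₂ p≡q))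
    simple {suc zero , s} {suc zero , s′} _ _ p≡q = cong (suc zero ,_)
      (lerp₁-injective (<⇒≢ top-lower<r)
        (trans (sym (lower₁ s)) (trans (cong lower p≡q) (lower₁ s′))))
    simple {suc (suc zero) , s} {suc (suc zero) , s′} _ _ p≡q = cong (suc (suc zero) ,_)
      (lerp₁-injective (<⇒≢ bottom-upper<r ∘ sym)
        (trans (sym (upper₂ s)) (trans (cong upper p≡q) (upper₂ s′))))
    simple {zero , _} {suc zero , s′} I _ p≡q =
      contradiction p≡q (apart₀₁ s′ I)
    simple {zero , _} {suc (suc zero) , s′} I _ p≡q =
      contradiction p≡q (apart₀₂ s′ I)
    simple {suc zero , _} {suc (suc zero) , s′} I _ p≡q =
      contradiction p≡q (apart₁₂ s′ I)
    simple {suc zero , s} {zero , _} _ J p≡q =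
      contradiction (sym p≡q) (apart₀₁ s J)
    simple {suc (suc zero) , s} {zero , _} _ J p≡q =
      contradiction (sym p≡q) (apart₀₂ s J)
    simple {suc (suc zero) , s} {suc zero , _} _ J p≡q =
      contradiction (sym p≡q) (apart₁₂ s J)

-- Drawing the contracted snark

place : Place → ℚ → Point
place a h = 2ℚ , h
place b h = 2ℚ , h + 1ℚ
place c h = 1ℚ , h
place d h = 3ℚ , h

module _ (k : ℕ) .{{_ : NonZero k}} where

  open Triangle (height k)

  base-height : Fin k → ℚ
  base-height t = height (toℕ t)

  -- p lies on the vertex or edge of kind κ in block t.  The constructor near covers
  -- the parts of the drawing in the strip, and far the rest of the three closing edges.
  -- There is no upper bound on the height of a point of the last block besides the
  -- triangle itself, since closing edges continue upwards.
  data Located (p : Point) (κ : Kind) (t : Fin k) : Set where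
    near : proj₂ p < height k + 3ℚ * proj₁ p →
           base-height t ℚ.≤ proj₂ p →
           (∀ {u} → t Fin.< u → proj₂ p < base-height u) →
           kind (column (proj₁ p)) (row (base-height t) (proj₂ p)) ≡ κ →
           Located p κ t
    far  : ∀ ρ → OnFarSides (radius ρ) p → ℕ.suc (toℕ t) ≡ k →
           inj₂ (around ρ) ≡ κ → Located p κ t

  -- `column` reads the ring back from its radius.
  radius-injective : ∀ {ρ ρ′} → radius ρ ≡ radius ρ′ → ρ ≡ ρ′
  radius-injective {ρ} {ρ′} eq = on-injective
    (trans (sym (column-radius ρ)) (trans (cong column eq) (column-radius ρ′)))
    where
    on-injective : ∀ {ρ ρ′} → on ρ ≡ on ρ′ → ρ ≡ ρ′
    on-injective refl = refl

  -- For two near points the height determines the block, and then `kind` is a function of the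
  -- coordinates. A near point lies in the wedge, which the far sides do not meet. For two far
  -- points the radius determines the ring, and the block is the last one.
  located-unique : ∀ {p κ κ′ t t′} → Located p κ t → Located p κ′ t′ →
                   κ ≡ κ′ × t ≡ t′
  located-unique {t = t} {t′} (near _ lo hi eq) (near _ lo′ hi′ eq′)
    with Fin.<-cmp t t′
  ... | tri< t<t′ _ _ = contradiction (<-≤-trans (hi t<t′) lo′) (<-irrefl refl)
  ... | tri≈ _ refl _ = trans (sym eq) eq′ , refl
  ... | tri> _ _ t′<t = contradiction (<-≤-trans (hi′ t′<t) lo) (<-irrefl refl)
  located-unique {t = t} (near y< lo _ _) (far _ P _ _) =
    contradiction P (near⇒¬far (≤-trans (0≤height (toℕ t)) lo) y<)
  located-unique {t′ = t′} (far _ P _ _) (near y< lo _ _) =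
    contradiction P (near⇒¬far (≤-trans (0≤height (toℕ t′)) lo) y<)
  located-unique (far ρ P last eq) (far ρ′ P′ last′ eq′)
    with refl ← radius-injective {ρ} {ρ′} (far-radius P P′) =
      trans (sym eq) eq′ ,
      Fin.toℕ-injective (ℕ.suc-injective (trans last (sym last′)))

  -- A point below the next block is below every later one and below `height k`, hence below
  -- `height k + 3ℚ * x` because x is positive.
  located-in-block : ∀ {x y κ} t → 0ℚ < x → base-height t ℚ.≤ y →
                     y < height (ℕ.suc (toℕ t)) →
                     kind (column x) (row (base-height t) y) ≡ κ →
                     Located (x , y) κ t
  located-in-block {x} t 0<x lo hi =
    near (<-trans (<-≤-trans hi (height-mono-≤ (Fin.toℕ<n t)))
                  (a<a+d (positive⁻¹ (3ℚ * x) {{pos*pos⇒pos 3ℚ x {{positive 0<x}}}})))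
         lo (λ t<u → <-≤-trans hi (height-mono-≤ t<u))

  located-place : ∀ ν t → Located (place ν (base-height t)) (inj₁ ν) t
  located-place a t = located-in-block t (0<radius middle) ≤-refl
    (height-<-suc (toℕ t)) (cong (kind (on middle)) (row-base _))
  located-place b t = located-in-block t (0<radius middle) (<⇒≤ q<q+1)
    q<q+1 (cong (kind (on middle)) (row-mid _))
  located-place c t = located-in-block t (0<radius inner) ≤-refl
    (height-<-suc (toℕ t)) (cong (kind (on inner)) (row-base _))
  located-place d t = located-in-block t (0<radius outer) ≤-refl
    (height-<-suc (toℕ t)) (cong (kind (on outer)) (row-base _))

  -- Classes of vertices and representatives of edges

  class : GoldbergVertex k → Place × Fin k
  class (v₁ t) = a , t
  class (v₂ t) = b , t
  class (v₃ t) = c , t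
  class (v₄ t) = c , t
  class (v₅ t) = d , t
  class (v₆ t) = d , t
  class (v₇ t) = a , t
  class (v₈ t) = b , t

  placeOf : Place × Fin k → Point
  placeOf (ν , t) = place ν (base-height t)

  -- A point serving two vertices would be located at both of them.
  placeOf-injective : ∀ {ν ν′} → placeOf ν ≡ placeOf ν′ → ν ≡ ν′
  placeOf-injective {ν , t} {ν′ , t′} eq
    with refl , refl ← located-unique (located-place ν t)
           (subst (λ p → Located p (inj₁ ν′) t′) (sym eq) (located-place ν′ t′)) = refl

  -- The letters of a link follow the order of the ends of its edge, so that no route has to be
  -- reversed.
  edge : Link → Fin k → GoldbergEdge k
  edge ab              = v₁v₂
  edge ca              = v₄v₇
  edge cb              = v₃v₈
  edge da              = v₆v₇
  edge db              = v₆v₈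
  edge (around inner)  = v₄v₃⁺
  edge (around middle) = v₂v₁⁺
  edge (around outer)  = v₅v₅⁺

  source target : GoldbergEdge k → Point
  source = placeOf ∘ class ∘ Multigraph.source (goldberg k)
  target = placeOf ∘ class ∘ Multigraph.target (goldberg k)

  -- Arcs for the single edges

  record Route (κ : Link) (t : Fin k) : Set where
    field
      path     : Path
    open Path path
    field
      starts   : start ≡ source (edge κ t)
      finishes : finish ≡ target (edge κ t)
      simple   : ∀ {p q} → Interior p → Interior q → at p ≡ at q → p ≡ q
      -- Through `located-unique`, this yields the conditions `avoids` and `disjoint` of a drawing.
      located  : ∀ {p} → Interior p → Located (at p) (inj₂ κ) t

  straight : ∀ {κ t} p q → p ≡ source (edge κ t) → q ≡ target (edge κ t) → p ≢ q →
             (∀ {s} → 0ℚ < s → s < 1ℚ → Located (lerp p q s) (inj₂ κ) t) →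
             Route κ t
  straight p q p≡ q≡ p≢q located = record
    { path     = record { bends = 0 ; corner = λ { zero → p ; (suc _) → q } }
    ; starts   = p≡
    ; finishes = q≡
    ; simple   = λ { {zero , _} {zero , _} _ _ eq →
                     cong (zero ,_) (lerp-injective p≢q eq) }
    -- The only segment begins at the start of the path, so interior parameters satisfy 0 < s.
    ; located  = λ { {zero , _} (_ , s<1 , 0<s) → located (0<s refl) s<1 }
    }

  source-around : ∀ ρ t → (radius ρ , exit ρ (base-height t)) ≡ source (edge (around ρ) t)
  source-around inner  t = refl
  source-around middle t = refl
  source-around outer  t = refl

  target-around : ∀ ρ t → (radius ρ , base-height (next k t)) ≡ target (edge (around ρ) t)
  target-around inner  t = refl
  target-around middle t = refl
  target-around outer  t = refl

  toℕ-next : ∀ t → toℕ (next k t) ≡ ℕ.suc (toℕ t) % k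
  toℕ-next t = Fin.toℕ-fromℕ< (ℕ.m%n<n (ℕ.suc (toℕ t)) k)

  toℕ-next-< : ∀ t → ℕ.suc (toℕ t) ℕ.< k → toℕ (next k t) ≡ ℕ.suc (toℕ t)
  toℕ-next-< t t+1<k = trans (toℕ-next t) (ℕ.m<n⇒m%n≡m t+1<k)

  toℕ-next-last : ∀ t → ℕ.suc (toℕ t) ≡ k → toℕ (next k t) ≡ 0
  toℕ-next-last t t+1≡k =
    trans (toℕ-next t) (trans (cong (_% k) t+1≡k) (ℕ.n%n≡0 k))

  kind-on-radius : ∀ ρ {h y} → exit ρ h < y →
                   kind (column (radius ρ)) (row h y) ≡ inj₂ (around ρ)
  kind-on-radius ρ {h} {y} e<y =
    trans (cong (λ z → kind z (row h y)) (column-radius ρ)) (kind-around ρ e<y)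

  -- For any ring, an edge leaving a block other than the last goes straight up the side x = r and
  -- stays below the base of the next block until it ends there.
  route-inner : ∀ ρ t → ℕ.suc (toℕ t) ℕ.< k → Route (around ρ) t
  route-inner ρ t t+1<k = straight (r , e) (r , e⁺)
    (source-around ρ t)
    (trans (cong (λ n → r , height n) (sym (toℕ-next-< t t+1<k))) (target-around ρ t))
    (<⇒≢ e<e⁺ ∘ cong proj₂)
    (λ {s} 0<s s<1 →
      let e<y  = lerp₁->ˡ 0<s s<1 e<e⁺
          y<e⁺ = lerp₁-<ʳ (<⇒≤ 0<s) s<1 e<e⁺
      -- The path computes its first coordinate as `lerp₁ r r s`, which equals r only
      -- propositionally.
      in subst (λ x → Located (x , lerp₁ e e⁺ s) (inj₂ (around ρ)) t)
           (sym (lerp₁-const r s))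
           (located-in-block t (0<radius ρ)
             (≤-trans (exit-≥ ρ) (<⇒≤ e<y)) y<e⁺ (kind-on-radius ρ e<y)))
    where
    r e e⁺ : ℚ
    r  = radius ρ
    e  = exit ρ (base-height t)
    e⁺ = height (ℕ.suc (toℕ t))
    e<e⁺ : e < e⁺
    e<e⁺ = exit-< ρ

  -- The successor of the last block is block 0, whose base has height 0; this is where the triangle
  -- returns to the side x = r.
  route-last : ∀ ρ t → ℕ.suc (toℕ t) ≡ k → Route (around ρ) t
  route-last ρ t t+1≡k = record
    { path     = A.path
    ; starts   = source-around ρ t
    ; finishes = trans (cong (λ n → r , height n) (sym (toℕ-next-last t t+1≡k)))
                       (target-around ρ t)
    ; simple   = A.simple
    ; located  = located
    }
    where
    r e : ℚ
    r = radius ρ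
    e = exit ρ (base-height t)
    0<3r : 0ℚ < 3ℚ * r
    0<3r = positive⁻¹ (3ℚ * r) {{pos*pos⇒pos 3ℚ r {{positive (0<radius ρ)}}}}
    e<top : e < height k + 3ℚ * r
    -- The exit is below the end of its block, which is `height k` for the last block.
    e<top = <-trans (subst (λ n → e < height n) t+1≡k (exit-< ρ)) (a<a+d 0<3r)
    module A = Arc r e (≤-trans (0≤height (toℕ t)) (exit-≥ ρ)) e<top
    -- No block follows the last one, so the upper bound in `near` is vacuous and the first side may
    -- rise past `height k`.
    above-t : ∀ {u y} → t Fin.< u → y < base-height u
    above-t {u} t<u = contradiction (subst (ℕ._≤ toℕ u) t+1≡k t<u) (ℕ.<⇒≱ (Fin.toℕ<n u))
    located : ∀ {p} → Path.Interior A.path p → Located (Path.at A.path p) (inj₂ (around ρ)) t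
    located {zero , s} I = subst (λ x → Located (x , lerp₁ e A.top s) (inj₂ (around ρ)) t)
      (sym (A.right₀ s))
      (near (proj₂ (A.near I)) (≤-trans (exit-≥ ρ) (<⇒≤ (proj₁ (A.near I))))
        above-t (kind-on-radius ρ (proj₁ (A.near I))))
    located {suc zero , _}       I = far ρ (A.far₁ I) t+1≡k refl
    located {suc (suc zero) , _} I = far ρ (A.far₂ I) t+1≡k refl

  module _ (t : Fin k) where
    private
      h = base-height t

    located-insideGap : ∀ {x y κ} → 1ℚ < x → x < 2ℚ → h ℚ.≤ y → y < height (ℕ.suc (toℕ t)) →
                        kind insideGap (row h y) ≡ κ → Located (x , y) κ t
    located-insideGap 1<x x<2 lo hi eq =
      located-in-block t (<-trans (0<radius inner) 1<x) lo hi
        (trans (cong (λ z → kind z _) (column-insideGap 1<x x<2)) eq)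

    located-outsideGap : ∀ {x y κ} → 2ℚ < x → x < 3ℚ → h ℚ.≤ y → y < height (ℕ.suc (toℕ t)) →
                         kind outsideGap (row h y) ≡ κ → Located (x , y) κ t
    located-outsideGap 2<x x<3 lo hi eq =
      located-in-block t (<-trans (0<radius middle) 2<x) lo hi
        (trans (cong (λ z → kind z _) (column-outsideGap 2<x x<3)) eq)

    module _ {s : ℚ} (0<s : 0ℚ < s) (s<1 : s < 1ℚ) where

      inside-> : 1ℚ < lerp₁ 1ℚ 2ℚ s
      inside-> = lerp₁->ˡ 0<s s<1 q<q+1

      inside-< : lerp₁ 1ℚ 2ℚ s < 2ℚ
      inside-< = lerp₁-<ʳ (<⇒≤ 0<s) s<1 q<q+1

      outside-> : 2ℚ < lerp₁ 3ℚ 2ℚ s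
      outside-> = lerp₁->ʳ (<⇒≤ 0<s) s<1 q<q+1

      outside-< : lerp₁ 3ℚ 2ℚ s < 3ℚ
      outside-< = lerp₁-<ˡ 0<s s<1 q<q+1

      low-> : h < lerp₁ h (h + 1ℚ) s
      low-> = lerp₁->ˡ 0<s s<1 q<q+1

      low-< : lerp₁ h (h + 1ℚ) s < h + 1ℚ
      low-< = lerp₁-<ʳ (<⇒≤ 0<s) s<1 q<q+1

      low-<⁺ : lerp₁ h (h + 1ℚ) s < height (ℕ.suc (toℕ t))
      low-<⁺ = <-trans low-< q<q+1

    route : ∀ κ → Route κ t
    route ab = straight _ _ refl refl (<⇒≢ q<q+1 ∘ cong proj₂) λ {s} 0<s s<1 →
      subst (λ x → Located (x , lerp₁ h (h + 1ℚ) s) (inj₂ ab) t) (sym (lerp₁-const 2ℚ s))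
        (located-in-block t (0<radius middle) (<⇒≤ (low-> 0<s s<1)) (low-<⁺ 0<s s<1)
          (cong (kind (on middle)) (row-low (low-> 0<s s<1) (low-< 0<s s<1))))
    route ca = straight _ _ refl refl (λ ()) λ {s} 0<s s<1 →
      subst (λ y → Located (lerp₁ 1ℚ 2ℚ s , y) (inj₂ ca) t) (sym (lerp₁-const h s))
        (located-insideGap (inside-> 0<s s<1) (inside-< 0<s s<1)
          ≤-refl (height-<-suc (toℕ t)) (cong (kind insideGap) (row-base h)))
    route cb = straight _ _ refl refl (λ ()) λ {s} 0<s s<1 →
      located-insideGap (inside-> 0<s s<1) (inside-< 0<s s<1)
        (<⇒≤ (low-> 0<s s<1)) (low-<⁺ 0<s s<1) (cong (kind insideGap) (row-above (low-> 0<s s<1)))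
    route da = straight _ _ refl refl (λ ()) λ {s} 0<s s<1 →
      subst (λ y → Located (lerp₁ 3ℚ 2ℚ s , y) (inj₂ da) t) (sym (lerp₁-const h s))
        (located-outsideGap (outside-> 0<s s<1) (outside-< 0<s s<1)
          ≤-refl (height-<-suc (toℕ t)) (cong (kind outsideGap) (row-base h)))
    route db = straight _ _ refl refl (λ ()) λ {s} 0<s s<1 →
      located-outsideGap (outside-> 0<s s<1) (outside-< 0<s s<1)
        (<⇒≤ (low-> 0<s s<1)) (low-<⁺ 0<s s<1) (cong (kind outsideGap) (row-above (low-> 0<s s<1)))
    -- The case t + 1 = k singles out the edges that close the cycles.
    route (around ρ) with ℕ.m≤n⇒m<n∨m≡n (Fin.toℕ<n t)
    ... | inj₁ t+1<k = route-inner ρ t t+1<k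
    ... | inj₂ t+1≡k = route-last ρ t t+1≡k

  -- The contracted graph and its drawing

  contracted : Multigraph
  contracted = contract (goldberg k) goldbergMatching

  open Multigraph contracted using () renaming (Edge to Edge′; _≈_ to _≈′_)

  -- Having equal classes is an equivalence relation, so only the generating pairs need checking:
  -- the ends of each matching edge share a class.
  class-cong : ∀ {u v} → u ≈′ v → class u ≡ class v
  class-cong = EqClosure.gfold isEquivalence class λ where
    (inj₁ refl) → refl
    (inj₂ (_ , (_ , here refl) , refl , refl)) → refl
    (inj₂ (_ , (_ , there (here refl)) , refl , refl)) → refl
    (inj₂ (_ , (_ , there (there (here refl))) , refl , refl)) → refl
    (inj₂ (_ , (_ , there (there (there (here refl)))) , refl , refl)) → refl

  -- Always the source of the matching edge, so that one forward `Joined` step leads to the other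
  -- vertex of the class.
  representative : Place × Fin k → GoldbergVertex k
  representative (a , t) = v₁ t
  representative (b , t) = v₂ t
  representative (c , t) = v₃ t
  representative (d , t) = v₅ t

  ≈-representative : ∀ v → representative (class v) ≈′ v
  ≈-representative (v₁ t) = ε
  ≈-representative (v₂ t) = ε
  ≈-representative (v₃ t) = ε
  ≈-representative (v₅ t) = ε
  ≈-representative (v₇ t) = EqClosure.return
    (inj₂ (v₁v₇ t , (t , here refl) , refl , refl))
  ≈-representative (v₈ t) = EqClosure.return
    (inj₂ (v₂v₈ t , (t , there (here refl)) , refl , refl))
  ≈-representative (v₄ t) = EqClosure.return
    (inj₂ (v₃v₄ t , (t , there (there (here refl))) , refl , refl))
  ≈-representative (v₆ t) = EqClosure.return
    (inj₂ (v₅v₆ t , (t , there (there (there (here refl)))) , refl , refl))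

  class-injective : ∀ {u v} → class u ≡ class v → u ≈′ v
  class-injective {u} {v} eq = E.trans (E.sym (≈-representative u))
    (subst (λ n → representative n ≈′ v) (sym eq) (≈-representative v))
    where module E = Setoid (Multigraph.vertices contracted)

  link : (e : Edge′) → ∃₂ λ κ t → edge κ t ≡ proj₁ e
  link (v₁v₂ t  , _) = ab , t , refl
  link (v₃v₈ t  , _) = cb , t , refl
  link (v₄v₇ t  , _) = ca , t , refl
  link (v₆v₇ t  , _) = da , t , refl
  link (v₆v₈ t  , _) = db , t , refl
  link (v₂v₁⁺ t , _) = around middle , t , refl
  link (v₄v₃⁺ t , _) = around inner , t , refl
  link (v₅v₅⁺ t , _) = around outer , t , refl
  link (v₁v₇ t  , e∉M) = contradiction (t , here refl) e∉M
  link (v₂v₈ t  , e∉M) = contradiction (t , there (here refl)) e∉M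
  link (v₃v₄ t  , e∉M) = contradiction (t , there (there (here refl))) e∉M
  link (v₅v₆ t  , e∉M) = contradiction (t , there (there (there (here refl)))) e∉M

  linkOf : Edge′ → Link
  linkOf e = proj₁ (link e)

  blockOf : Edge′ → Fin k
  blockOf e = proj₁ (proj₂ (link e))

  edge-linkOf : ∀ e → edge (linkOf e) (blockOf e) ≡ proj₁ e
  edge-linkOf e = proj₂ (proj₂ (link e))

  -- ⊥ is a proof-irrelevant record, so any two proofs of e ∉ M are definitionally
  -- equal; this is what makes ∃-≡ hold without function extensionality.
  link-injective : ∀ {e f} → linkOf e ≡ linkOf f → blockOf e ≡ blockOf f → e ≡ f
  link-injective {e} {f} κ≡ t≡ = ∃-≡ (trans (sym (edge-linkOf e))
    (trans (cong₂ edge κ≡ t≡) (edge-linkOf f)))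
    where
    ∃-≡ : ∀ {e f : Edge′} → proj₁ e ≡ proj₁ f → e ≡ f
    ∃-≡ refl = refl

  drawing : Drawing contracted
  drawing = record
    { position = record
      { to        = placeOf ∘ class
      ; cong      = cong placeOf ∘ class-cong
      ; injective = class-injective ∘ placeOf-injective
      }
    ; path     = λ e → Route.path (routeOf e)
    ; starts   = λ e → trans (Route.starts (routeOf e)) (cong source (edge-linkOf e))
    ; finishes = λ e → trans (Route.finishes (routeOf e)) (cong target (edge-linkOf e))
    ; simple   = λ e → Route.simple (routeOf e)
    -- A common point would be located both at a link and at a place, which are different summands
    -- of `Kind`.
    ; avoids   = λ e I v p≡v → case proj₁ (located-unique
        (subst (λ p → Located p _ _) p≡v (Route.located (routeOf e) I))
        (uncurry located-place (class v))) of λ ()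
    ; disjoint = λ {e} {f} e≢f I J p≡q →
        -- A common point forces the same link in the same block, hence the same edge.
        let κ≡ , t≡ = located-unique
              (subst (λ p → Located p _ _) p≡q (Route.located (routeOf e) I))
              (Route.located (routeOf f) J)
        in e≢f (link-injective {e} {f} (inj₂-injective κ≡) t≡)
    }
    where
    routeOf : ∀ e → Route (linkOf e) (blockOf e)
    routeOf e = route (blockOf e) (linkOf e)

  -- The perfect matching

  mate : GoldbergVertex k → GoldbergEdge k
  mate (v₁ t) = v₁v₇ t
  mate (v₂ t) = v₂v₈ t
  mate (v₃ t) = v₃v₄ t
  mate (v₄ t) = v₃v₄ t
  mate (v₅ t) = v₅v₆ t
  mate (v₆ t) = v₅v₆ t
  mate (v₇ t) = v₁v₇ t
  mate (v₈ t) = v₂v₈ t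

  open Multigraph (goldberg k) using (Incident)

  mate-matched : ∀ v → goldbergMatching (mate v) × Incident (mate v) v
  mate-matched (v₁ t) = (t , here refl) , inj₁ refl
  mate-matched (v₂ t) = (t , there (here refl)) , inj₁ refl
  mate-matched (v₃ t) = (t , there (there (here refl))) , inj₁ refl
  mate-matched (v₄ t) = (t , there (there (here refl))) , inj₂ refl
  mate-matched (v₅ t) = (t , there (there (there (here refl)))) , inj₁ refl
  mate-matched (v₆ t) = (t , there (there (there (here refl)))) , inj₂ refl
  mate-matched (v₇ t) = (t , here refl) , inj₂ refl
  mate-matched (v₈ t) = (t , there (here refl)) , inj₂ refl

  -- At either end of a matching edge `mate` computes to that edge.
  mate-unique : ∀ {v e} → goldbergMatching e × Incident e v → mate v ≡ e
  mate-unique ((_ , here refl) , inj₁ refl) = refl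
  mate-unique ((_ , here refl) , inj₂ refl) = refl
  mate-unique ((_ , there (here refl)) , inj₁ refl) = refl
  mate-unique ((_ , there (here refl)) , inj₂ refl) = refl
  mate-unique ((_ , there (there (here refl))) , inj₁ refl) = refl
  mate-unique ((_ , there (there (here refl))) , inj₂ refl) = refl
  mate-unique ((_ , there (there (there (here refl)))) , inj₁ refl) = refl
  mate-unique ((_ , there (there (there (here refl)))) , inj₂ refl) = refl

  isPerfectMatching : IsPerfectMatching (goldberg k) goldbergMatching
  isPerfectMatching = record
    { loopless = λ where
        (_ , here refl) ()
        (_ , there (here refl)) ()
        (_ , there (there (here refl))) ()
        (_ , there (there (there (here refl)))) ()
    ; covers   = λ v → mate v , mate-matched v , mate-unique
    }

mainTheorem4 : (k : ℕ) .{{_ : NonZero k}} → 5 ≤ k → k % 2 ≡ 1 →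
    IsPlanarizingPerfectMatching (goldberg k) goldbergMatching
mainTheorem4 k _ _ = isPerfectMatching k , drawing k
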